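{- Let $C_{(=,\leq)}(x,y)$ be the bivariate generating function of the Catalan words avoiding the ordered pair of relations $(=,\leq)$, where $x$ marks the length and $y$ marks the number of descents. Then $$C_{(=,\leq)}(x,y)=\frac{1 - x + 2 x y - \sqrt{1 - 2 x + x^2 - 4 x^2 y - 4 x^3 y}}{2xy}.$$
   Context: A Catalan word of length $n$ is a word $w=w_1w_2\cdots w_n$ over the non-negative integers with $w_1=0$ and $0\leq w_i\leq w_{i-1}+1$ for $i=2,\dots,n$; the empty word is the unique Catalan word of length $0$. For relations $X,Y\in\{<,>,\leq,\geq,=,\neq\}$, a word $w$ contains the pattern $(X,Y)$ if there is an index $i\geq 1$ (with $i+2\le n$) such that $w_i\,X\,w_{i+1}$ and $w_{i+1}\,Y\,w_{i+2}$; otherwise $w$ avoids $(X,Y)$. The number of descents $\mathrm{des}(w)$ is the number of indices $i$ with $w_i>w_{i+1}$. The bivariate generating function is $C_{(X,Y)}(x,y)=\sum_{w}x^{|w|}y^{\mathrm{des}(w)}$, the sum being over all Catalan words $w$ (of any length $|w|\geq 0$) avoiding $(X,Y)$. Identities are between formal power series in $x$ with coefficients polynomials in $y$ (after clearing denominators); the square root of a power series with constant term $1$ is the one with constant term $1$. -}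

module Defs where

open import Data.Bool.Base using (if_then_else_)
open import Data.Empty using (⊥)
open import Data.Integer.Base as ℤ using (ℤ)
open import Data.List.Base
  using (List; []; _∷_; length; map; filter; foldr; concatMap; upTo)
open import Data.List.Membership.Propositional using (_∈_; lose; find)
open import Data.List.Membership.Propositional.Properties
  using (∈-map⁺; ∈-map⁻; ∈-concatMap⁺; ∈-concatMap⁻; ∈-upTo⁺; ∈-upTo⁻)
open import Data.List.Properties using (∷-injectiveʳ)
open import Data.List.Relation.Unary.All as All using ([])
import Data.List.Relation.Unary.All.Properties as All
import Data.List.Relation.Unary.AllPairs as AllPairs
import Data.List.Relation.Unary.AllPairs.Properties as AllPairs
open import Data.List.Relation.Unary.Any using (here; there)
open import Data.List.Relation.Unary.Linked using (Linked; [-]; _∷_)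
open import Data.List.Relation.Unary.Unique.Propositional using (Unique; []; _∷_)
import Data.List.Relation.Unary.Unique.Propositional.Properties as Unique
open import Data.Nat.Base using (ℕ; zero; suc; _∸_; _≤_; s≤s)
open import Data.Nat.Properties using (_<?_)
open import Data.Product.Base using (∃-syntax; _×_; _,_)
open import Data.Sum.Base using ([_,_]; inj₁; inj₂)
open import Function.Bundles using (_⇔_; mk⇔)
open import Level using (0ℓ)
open import Relation.Binary.Core using (Rel)
open import Relation.Binary.Definitions using (Decidable)
open import Relation.Binary.PropositionalEquality using (_≡_; _≢_; refl)
import Relation.Unary as U
open import Relation.Nullary using (¬_; does; yes; no)
open import Relation.Nullary.Decidable using (¬?; map′; _×-dec_; _⊎-dec_)

------------------------------------------------------------------------
-- Words

data IsCatalan : List ℕ → Set where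
  empty : IsCatalan []
  word  : ∀ {w} → Linked (λ a b → b ≤ suc a) (0 ∷ w) → IsCatalan (0 ∷ w)

data Contains (X Y : Rel ℕ 0ℓ) : List ℕ → Set where
  here  : ∀ {a b c w} → X a b → Y b c → Contains X Y (a ∷ b ∷ c ∷ w)
  there : ∀ {a w} → Contains X Y w → Contains X Y (a ∷ w)

Avoids : Rel ℕ 0ℓ → Rel ℕ 0ℓ → List ℕ → Set
Avoids X Y w = ¬ Contains X Y w

des : List ℕ → ℕ
des []          = 0
des (_ ∷ [])    = 0
des (a ∷ b ∷ w) = if does (b <? a) then suc (des (b ∷ w)) else des (b ∷ w)

module _ {X Y : Rel ℕ 0ℓ} (X? : Decidable X) (Y? : Decidable Y) where

  contains? : U.Decidable (Contains X Y)
  contains? []              = no λ ()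
  contains? (_ ∷ [])        = no λ { (there ()) }
  contains? (_ ∷ _ ∷ [])    = no λ { (there (there ())) }
  contains? (a ∷ b ∷ c ∷ w) =
    map′ [ (λ (p , q) → here p q) , there ]
         (λ { (here p q) → inj₁ (p , q) ; (there r) → inj₂ r })
         ((X? a b ×-dec Y? b c) ⊎-dec contains? (b ∷ c ∷ w))

  avoids? : U.Decidable (Avoids X Y)
  avoids? w = ¬? (contains? w)

-- The words of length 1 + n with first letter a in which every letter
-- exceeds its predecessor by at most 1.
wordsFrom : ℕ → ℕ → List (List ℕ)
wordsFrom a zero    = (a ∷ []) ∷ []
wordsFrom a (suc n) = map (a ∷_) (concatMap (λ b → wordsFrom b n) (upTo (suc (suc a))))

-- All Catalan words of length n, each listed once: see ∈-catalanWords
-- and catalanWords-unique.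
catalanWords : ℕ → List (List ℕ)
catalanWords zero    = [] ∷ []
catalanWords (suc n) = wordsFrom 0 n

private

  Starts : ℕ → ℕ → List ℕ → Set
  Starts a n w = ∃[ v ] w ≡ a ∷ v × length v ≡ n × Linked (λ a b → b ≤ suc a) w

  wordsFrom-sound : ∀ a n {w} → w ∈ wordsFrom a n → Starts a n w
  wordsFrom-sound a zero    (here refl) = [] , refl , refl , [-]
  wordsFrom-sound a (suc n) w∈
    with v , v∈ , refl ← ∈-map⁻ (a ∷_) w∈
    with b , b∈ , v∈b ← find (∈-concatMap⁻ (λ b → wordsFrom b n) {xs = upTo (suc (suc a))} v∈)
    with _ , refl , refl , l ← wordsFrom-sound b n v∈b
    with s≤s b≤1+a ← ∈-upTo⁻ b∈
    = _ , refl , refl , b≤1+a ∷ l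

  wordsFrom-complete : ∀ a v → Linked (λ a b → b ≤ suc a) (a ∷ v) →
                       (a ∷ v) ∈ wordsFrom a (length v)
  wordsFrom-complete a []      _       = here refl
  wordsFrom-complete a (b ∷ v) (p ∷ l) =
    ∈-map⁺ (a ∷_) (∈-concatMap⁺ (λ b → wordsFrom b (length v))
      (lose (∈-upTo⁺ (s≤s p)) (wordsFrom-complete b v l)))

  wordsFrom-disjoint : ∀ n {b c} → b ≢ c → ∀ {w} →
                       w ∈ wordsFrom b n × w ∈ wordsFrom c n → ⊥
  wordsFrom-disjoint n {b} {c} b≢c (p , q)
    with _ , refl , _ ← wordsFrom-sound b n p
    with _ , refl , _ ← wordsFrom-sound c n q
    = b≢c refl

  wordsFrom-unique : ∀ a n → Unique (wordsFrom a n)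
  wordsFrom-unique a zero    = [] ∷ []
  wordsFrom-unique a (suc n) = Unique.map⁺ ∷-injectiveʳ (Unique.concat⁺
    (All.map⁺ (All.universal (λ b → wordsFrom-unique b n) (upTo (suc (suc a)))))
    (AllPairs.map⁺ (AllPairs.map (wordsFrom-disjoint n) (Unique.upTo⁺ (suc (suc a))))))

∈-catalanWords : ∀ n {w} → w ∈ catalanWords n ⇔ (IsCatalan w × length w ≡ n)
∈-catalanWords n = mk⇔ (to n) from
  where
  to : ∀ n {w} → w ∈ catalanWords n → IsCatalan w × length w ≡ n
  to zero    (here refl) = empty , refl
  to (suc n) w∈ with _ , refl , refl , l ← wordsFrom-sound 0 n w∈ = word l , refl

  from : ∀ {n w} → IsCatalan w × length w ≡ n → w ∈ catalanWords n
  from (empty , refl)  = here refl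
  from (word l , refl) = wordsFrom-complete 0 _ l

catalanWords-unique : ∀ n → Unique (catalanWords n)
catalanWords-unique zero    = [] ∷ []
catalanWords-unique (suc n) = wordsFrom-unique 0 n

------------------------------------------------------------------------
-- ℤ[y]: coefficient lists, constant coefficient first.  Trailing zeros
-- are allowed, so equality is _≈ᴾ_ rather than _≡_.

Poly : Set
Poly = List ℤ

coeff : Poly → ℕ → ℤ
coeff []      _       = ℤ.0ℤ
coeff (a ∷ p) zero    = a
coeff (a ∷ p) (suc k) = coeff p k

infix  4 _≈ᴾ_
infixl 6 _+ᴾ_
infixl 7 _*ᴾ_

_≈ᴾ_ : Rel Poly 0ℓ
p ≈ᴾ q = ∀ k → coeff p k ≡ coeff q k

0ᴾ 1ᴾ : Poly
0ᴾ = []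
1ᴾ = ℤ.1ℤ ∷ []

_+ᴾ_ : Poly → Poly → Poly
[]      +ᴾ q       = q
(a ∷ p) +ᴾ []      = a ∷ p
(a ∷ p) +ᴾ (b ∷ q) = (a ℤ.+ b) ∷ (p +ᴾ q)

-ᴾ_ : Poly → Poly
-ᴾ_ = map (λ a → ℤ.- a)

_*ᴾ_ : Poly → Poly → Poly
[]      *ᴾ q = 0ᴾ
(a ∷ p) *ᴾ q = map (a ℤ.*_) q +ᴾ (ℤ.0ℤ ∷ (p *ᴾ q))

sumᴾ : List Poly → Poly
sumᴾ = foldr _+ᴾ_ 0ᴾ

y^_ : ℕ → Poly
y^ zero  = 1ᴾ
y^ suc k = ℤ.0ℤ ∷ (y^ k)

------------------------------------------------------------------------
-- ℤ[y][[x]]: a series f has f n as its coefficient of xⁿ.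

Series : Set
Series = ℕ → Poly

infix  4 _≈_
infixl 6 _+_ _-_
infixl 7 _*_
infixr 8 _^_
infix  9 #_

_≈_ : Rel Series 0ℓ
f ≈ g = ∀ n → f n ≈ᴾ g n

const : Poly → Series
const p zero    = p
const p (suc _) = 0ᴾ

#_ : ℕ → Series
# k = const ((ℤ.+ k) ∷ [])

x : Series
x 1 = 1ᴾ
x _ = 0ᴾ

y : Series
y = const (y^ 1)

_+_ : Series → Series → Series
(f + g) n = f n +ᴾ g n

_-_ : Series → Series → Series
(f - g) n = f n +ᴾ (-ᴾ g n)

_*_ : Series → Series → Series
(f * g) n = sumᴾ (map (λ i → f i *ᴾ g (n ∸ i)) (upTo (suc n)))

_^_ : Series → ℕ → Series
f ^ zero  = # 1
f ^ suc k = f * f ^ k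

-- The root with constant term 1.  A predicate, since not every series
-- over ℤ[y] with constant term 1 has a square root over ℤ[y].
record _IsSqrtOf_ (s f : Series) : Set where
  field
    square       : s * s ≈ f
    constantTerm : s 0 ≈ᴾ 1ᴾ

C : {X Y : Rel ℕ 0ℓ} → Decidable X → Decidable Y → Series
C X? Y? n = sumᴾ (map (λ w → y^ des w) (filter (avoids? X? Y?) (catalanWords n)))

{-# OPTIONS --safe #-}

-- For a letter a let G a and E a be the generating functions of the words that
-- may follow a, when that a is not, respectively is, preceded by another a, and
-- let H a be the sum of the G b over b < a.  Then
--   E a = 1 + x y H a,   G a = 1 + x (y H a + E a + G (a + 1)),
-- and A = x G 0 enumerates the nonempty words.  Cutting a word at the first
-- letter below its first letter a suggests x G a = A E a.  The defects
-- x G a - A E a satisfy a linear system whose right-hand side is divisible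
-- by x, so they all vanish.  The case a = 1 gives
--   A = x + x² + x A + x y A²,
-- which says that 1 - x - 2 x y A squares to the discriminant.  Square roots
-- with constant term 1 are unique, again by divisibility by powers of x.

module Submission where

open import Algebra.Bundles using (CommutativeRing; RawRing)
import Algebra.Morphism.RingMonomorphism as RingMonomorphism
open import Algebra.Morphism.Structures using (module RingMorphisms)
import Algebra.Solver.Ring as RingSolver
open import Algebra.Solver.Ring.AlmostCommutativeRing
  using (_-Raw-AlmostCommutative⟶_; fromCommutativeRing)
open import Data.Bool.Base using (Bool; if_then_else_; true; false)
open import Data.Integer.Base as ℤ using (ℤ; +_)
import Data.Integer.Properties as ℤ
open import Data.List.Base
  using (List; []; _∷_; _++_; map; filter; concatMap; upTo; applyUpTo)
open import Data.List.Properties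
  using (map-++; map-∘; map-upTo; concatMap-++; upTo-∷ʳ; ++-identityʳ)
import Data.Maybe.Base as Maybe
open import Data.Nat.Base using (ℕ; zero; suc; _∸_; _≤_; _<_; s≤s; z<s)
open import Data.Nat.Properties
  using (_≟_; _≤?_; _<?_; ≤-refl; ≤⇒≯; <⇒≱; <⇒≢; n<1+n; n≤1+n; m<n⇒m<1+n)
open import Data.Product using (∃; _×_; _,_)
open import Function.Base using (_∘_; id)
open import Level using (0ℓ)
open import Relation.Binary.PropositionalEquality as ≡
  using (_≡_; _≢_; cong; cong₂; ≢-sym)
open import Relation.Nullary using (does)
open import Relation.Nullary.Decidable using (dec-true; dec-false; dec⇒maybe)

-- Formal power series over a commutative ring.

module PowerSeries {c ℓ} (R : CommutativeRing c ℓ) where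

  open CommutativeRing R
  open import Relation.Binary.Reasoning.Setoid setoid
  open import Algebra.Properties.CommutativeSemigroup
    +-commutativeSemigroup using (interchange)

  -- The Cauchy product, by recursion on the degree: writing f as f 0 plus x times `f ∘ suc` avoids
  -- index subtraction and makes the ring laws structural inductions.
  conv : (ℕ → Carrier) → (ℕ → Carrier) → ℕ → Carrier
  conv f g zero    = f 0 * g 0
  conv f g (suc n) = f 0 * g (suc n) + conv (f ∘ suc) g n

  one : ℕ → Carrier
  one zero    = 1#
  one (suc _) = 0#

  conv-cong : ∀ {f f′ g g′} → (∀ n → f n ≈ f′ n) → (∀ n → g n ≈ g′ n) →
              ∀ n → conv f g n ≈ conv f′ g′ n
  conv-cong f≈ g≈ zero    = *-cong (f≈ 0) (g≈ 0)
  conv-cong f≈ g≈ (suc n) =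
    +-cong (*-cong (f≈ 0) (g≈ (suc n))) (conv-cong (f≈ ∘ suc) g≈ n)

  conv-zeroˡ : ∀ {f} → (∀ n → f n ≈ 0#) → ∀ g n → conv f g n ≈ 0#
  conv-zeroˡ f≈0 g zero    = trans (*-congʳ (f≈0 0)) (zeroˡ _)
  conv-zeroˡ f≈0 g (suc n) = trans
    (+-cong (trans (*-congʳ (f≈0 0)) (zeroˡ _)) (conv-zeroˡ (f≈0 ∘ suc) g n))
    (+-identityˡ 0#)

  conv-const : ∀ {f} → (∀ n → f (suc n) ≈ 0#) → ∀ g n → conv f g n ≈ f 0 * g n
  conv-const f≈0 g zero    = refl
  conv-const f≈0 g (suc n) = trans (+-congˡ (conv-zeroˡ f≈0 g n)) (+-identityʳ _)

  -- The mirror image of the defining recursion: here the constant term of the right factor is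
  -- peeled off. Commutativity follows by playing the two recursions against each other.
  conv-sucʳ : ∀ f g n → conv f g (suc n) ≈ conv f (g ∘ suc) n + f (suc n) * g 0
  conv-sucʳ f g zero    = refl
  conv-sucʳ f g (suc n) = trans (+-congˡ (conv-sucʳ (f ∘ suc) g n)) (sym (+-assoc _ _ _))

  conv-comm : ∀ f g n → conv f g n ≈ conv g f n
  conv-comm f g zero    = *-comm _ _
  conv-comm f g (suc n) = begin
    f 0 * g (suc n) + conv (f ∘ suc) g n   ≈⟨ +-cong (*-comm _ _) (conv-comm (f ∘ suc) g n) ⟩
    g (suc n) * f 0 + conv g (f ∘ suc) n   ≈⟨ +-comm _ _ ⟩
    conv g (f ∘ suc) n + g (suc n) * f 0   ≈⟨ conv-sucʳ g f n ⟨
    conv g f (suc n)                       ∎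

  conv-distribʳ : ∀ h f g n → conv (λ m → f m + g m) h n ≈ conv f h n + conv g h n
  conv-distribʳ h f g zero    = distribʳ _ _ _
  conv-distribʳ h f g (suc n) = trans
    (+-cong (distribʳ _ _ _) (conv-distribʳ h (f ∘ suc) (g ∘ suc) n))
    (interchange _ _ _ _)

  conv-distribˡ : ∀ h f g n → conv h (λ m → f m + g m) n ≈ conv h f n + conv h g n
  conv-distribˡ h f g n = begin
    conv h (λ m → f m + g m) n  ≈⟨ conv-comm h _ n ⟩
    conv (λ m → f m + g m) h n  ≈⟨ conv-distribʳ h f g n ⟩
    conv f h n + conv g h n     ≈⟨ +-cong (conv-comm f h n) (conv-comm g h n) ⟩
    conv h f n + conv h g n     ∎

  conv-scaleˡ : ∀ a f g n → conv (λ m → a * f m) g n ≈ a * conv f g n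
  conv-scaleˡ a f g zero    = *-assoc _ _ _
  conv-scaleˡ a f g (suc n) = trans
    (+-cong (*-assoc _ _ _) (conv-scaleˡ a (f ∘ suc) g n))
    (sym (distribˡ _ _ _))

  conv-assoc : ∀ f g h n → conv (conv f g) h n ≈ conv f (conv g h) n
  conv-assoc f g h zero    = *-assoc _ _ _
  conv-assoc f g h (suc n) = begin
    f 0 * g 0 * h (suc n) + conv (λ m → f 0 * g (suc m) + conv (f ∘ suc) g m) h n
      ≈⟨ +-cong (*-assoc _ _ _) (conv-distribʳ h (λ m → f 0 * g (suc m)) (conv (f ∘ suc) g) n) ⟩
    f 0 * (g 0 * h (suc n)) + (conv (λ m → f 0 * g (suc m)) h n + conv (conv (f ∘ suc) g) h n)
      ≈⟨ +-congˡ (+-cong (conv-scaleˡ (f 0) (g ∘ suc) h n) (conv-assoc (f ∘ suc) g h n)) ⟩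
    f 0 * (g 0 * h (suc n)) + (f 0 * conv (g ∘ suc) h n + conv (f ∘ suc) (conv g h) n)
      ≈⟨ +-assoc _ _ _ ⟨
    f 0 * (g 0 * h (suc n)) + f 0 * conv (g ∘ suc) h n + conv (f ∘ suc) (conv g h) n
      ≈⟨ +-congʳ (distribˡ _ _ _) ⟨
    f 0 * conv g h (suc n) + conv (f ∘ suc) (conv g h) n ∎

  -- Divisibility by the n-th power of x, stated through coefficients.
  Vanishes : ℕ → (ℕ → Carrier) → Set ℓ
  Vanishes n f = ∀ {m} → m < n → f m ≈ 0#

  conv-vanishes : ∀ f g n → Vanishes n f → Vanishes n (conv f g)
  conv-vanishes f g n f≈0 {zero}  m<n = trans (*-congʳ (f≈0 m<n)) (zeroˡ _)
  conv-vanishes f g (suc n) f≈0 {suc m} (s≤s m<n) = trans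
    (+-cong (trans (*-congʳ (f≈0 z<s)) (zeroˡ _))
            (conv-vanishes (f ∘ suc) g n (λ m<n → f≈0 (s≤s m<n)) m<n))
    (+-identityˡ 0#)

  one-identityˡ : ∀ f n → conv one f n ≈ f n
  one-identityˡ f n = trans (conv-const (λ _ → refl) f n) (*-identityˡ _)

  powerSeriesRing : CommutativeRing c ℓ
  powerSeriesRing = record
    { _≈_ = λ f g → ∀ n → f n ≈ g n
    ; _+_ = λ f g n → f n + g n
    ; _*_ = conv
    ; -_  = λ f n → - f n
    ; 0#  = λ _ → 0#
    ; 1#  = one
    ; isCommutativeRing = record
      { isRing = record
        { +-isAbelianGroup = record
          { isGroup = record
            { isMonoid = record
              { isSemigroup = record
                { isMagma = record
                  { isEquivalence = record
                    { refl  = λ _ → refl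
                    ; sym   = λ p n → sym (p n)
                    ; trans = λ p q n → trans (p n) (q n)
                    }
                  ; ∙-cong = λ p q n → +-cong (p n) (q n)
                  }
                ; assoc = λ f g h n → +-assoc (f n) (g n) (h n)
                }
              ; identity = (λ f n → +-identityˡ (f n)) , (λ f n → +-identityʳ (f n))
              }
            ; inverse = (λ f n → -‿inverseˡ (f n)) , (λ f n → -‿inverseʳ (f n))
            ; ⁻¹-cong = λ p n → -‿cong (p n)
            }
          ; comm = λ f g n → +-comm (f n) (g n)
          }
        ; *-cong     = conv-cong
        ; *-assoc    = conv-assoc
        ; *-identity = one-identityˡ , λ f n → trans (conv-comm f one n) (one-identityˡ f n)
        ; distrib    = conv-distribˡ , conv-distribʳ
        }
      ; *-comm = conv-comm
      }
    }

-- Consequences of the recurrences, and square roots, in an abstract commutative ring.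

module CatalanAlgebra {c ℓ} (R : CommutativeRing c ℓ)
  (morphism : CommutativeRing.rawRing ℤ.+-*-commutativeRing
              -Raw-AlmostCommutative⟶ fromCommutativeRing R) where

  open CommutativeRing R
  open _-Raw-AlmostCommutative⟶_ morphism using (0-homo) renaming (⟦_⟧ to ⟨_⟩)
  open RingSolver _ (fromCommutativeRing R) morphism
    (λ a b → Maybe.map (λ eq → reflexive (cong ⟨_⟩ eq)) (dec⇒maybe (a ℤ.≟ b)))
    using (solve; _:=_; con; _:+_; _:*_; _:-_; :-_)
  open import Relation.Binary.Reasoning.Setoid setoid

  private
    -- Images of integers, so that they agree with the constants `con` of the solver and, in the
    -- ring of series, with the numerals `# 1`, `# 2` and `# 4`.
    one two four : Carrier
    one  = ⟨ + 1 ⟩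
    two  = ⟨ + 2 ⟩
    four = ⟨ + 4 ⟩

  -‿cong₂ : ∀ {a b c d} → a ≈ b → c ≈ d → a - c ≈ b - d
  -‿cong₂ p q = +-cong p (-‿cong q)

  ≈⇒-≈0 : ∀ {a b} → a ≈ b → a - b ≈ 0#
  ≈⇒-≈0 p = trans (+-congʳ p) (-‿inverseʳ _)

  -≈0⇒≈ : ∀ {a b} → a - b ≈ 0# → a ≈ b
  -≈0⇒≈ {a} {b} p = begin
    a          ≈⟨ solve 2 (λ a b → a := (a :- b) :+ b) refl a b ⟩
    a - b + b  ≈⟨ +-congʳ p ⟩
    0# + b     ≈⟨ +-identityˡ b ⟩
    b          ∎

  module Decomposition (x y : Carrier) (G E H : ℕ → Carrier)
    (G-rec  : ∀ a → G a ≈ one + x * (y * H a + E a + G (suc a)))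
    (E-rec  : ∀ a → E a ≈ one + x * (y * H a))
    (H-zero : H 0 ≈ 0#)
    (H-suc  : ∀ a → H (suc a) ≈ H a + G a) where

    A : Carrier
    A = x * G 0

    defect : ℕ → Carrier
    defect a = x * G a - A * E a

    E-zero : E 0 ≈ one
    E-zero = begin
      E 0                       ≈⟨ E-rec 0 ⟩
      one + x * (y * H 0)       ≈⟨ +-congˡ (*-congˡ (*-congˡ (trans H-zero (sym 0-homo)))) ⟩
      one + x * (y * ⟨ + 0 ⟩)   ≈⟨ solve 2 (λ x y → con (+ 1) :+ x :* (y :* con (+ 0))
                                                  := con (+ 1)) refl x y ⟩
      one                       ∎

    E-suc : ∀ a → E (suc a) ≈ E a + x * (y * G a)
    E-suc a = begin
      E (suc a)                         ≈⟨ E-rec (suc a) ⟩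
      one + x * (y * H (suc a))         ≈⟨ +-congˡ (*-congˡ (*-congˡ (H-suc a))) ⟩
      one + x * (y * (H a + G a))       ≈⟨ solve 4 (λ x y h g →
                                             con (+ 1) :+ x :* (y :* (h :+ g)) :=
                                             con (+ 1) :+ x :* (y :* h) :+ x :* (y :* g))
                                             refl x y (H a) (G a) ⟩
      one + x * (y * H a) + x * (y * G a) ≈⟨ +-congʳ (E-rec a) ⟨
      E a + x * (y * G a)               ∎

    -- The recurrence for `E` absorbs the `H` term of the recurrence for `G`.
    G-split : ∀ a → G a ≈ E a + x * E a + x * G (suc a)
    G-split a = begin
      G a                                          ≈⟨ G-rec a ⟩
      one + x * (y * H a + E a + G (suc a))        ≈⟨ solve 5 (λ x y h e g →
                                                        con (+ 1) :+ x :* (y :* h :+ e :+ g) :=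
                                                        con (+ 1) :+ x :* (y :* h) :+ x :* e :+ x :* g)
                                                        refl x y (H a) (E a) (G (suc a)) ⟩
      one + x * (y * H a) + x * E a + x * G (suc a) ≈⟨ +-congʳ (+-congʳ (E-rec a)) ⟨
      E a + x * E a + x * G (suc a)                ∎

    G-split-zero : G 0 ≈ one + x + x * G 1
    G-split-zero = begin
      G 0                        ≈⟨ G-split 0 ⟩
      E 0 + x * E 0 + x * G 1    ≈⟨ +-congʳ (+-cong E-zero (*-congˡ E-zero)) ⟩
      one + x * one + x * G 1    ≈⟨ solve 2 (λ x g → con (+ 1) :+ x :* con (+ 1) :+ x :* g
                                             := con (+ 1) :+ x :+ x :* g) refl x (G 1) ⟩
      one + x + x * G 1          ∎

    E-one : E 1 ≈ one + x * (y * G 0)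
    E-one = trans (E-suc 0) (+-congʳ E-zero)

    -- The quadratic equation for A is not yet available: its error term is
    -- eliminated using the case a = 0, whence the summand with defect 1.
    defect-contracts : ∀ a → defect a ≈
      x * (defect (suc a) + (defect a * (y * A) + defect 1 * - E a))
    defect-contracts a = sym (begin
      x * ((x * G (suc a) - A * E (suc a)) + ((x * G a - A * E a) * (y * A) + (x * G 1 - A * E 1) * - E a))
        ≈⟨ *-congˡ (+-cong (-‿cong₂ refl (*-congˡ (E-suc a)))
             (+-congˡ (*-congʳ (-‿cong₂ refl (*-congˡ E-one))))) ⟩
      x * ((x * G (suc a) - x * G 0 * (E a + x * (y * G a))) +
           ((x * G a - x * G 0 * E a) * (y * (x * G 0)) + (x * G 1 - x * G 0 * (one + x * (y * G 0))) * - E a))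
        -- Every term containing g₀ cancels: both sides reduce to x * x * (g′ - g₁ * e).
        ≈⟨ solve 7 (λ x y g₀ g₁ g g′ e →
             x :* ((x :* g′ :- x :* g₀ :* (e :+ x :* (y :* g))) :+
             ((x :* g :- x :* g₀ :* e) :* (y :* (x :* g₀)) :+
               (x :* g₁ :- x :* g₀ :* (con (+ 1) :+ x :* (y :* g₀))) :* :- e))
             := x :* (e :+ x :* e :+ x :* g′) :- x :* (con (+ 1) :+ x :+ x :* g₁) :* e)
             refl x y (G 0) (G 1) (G a) (G (suc a)) (E a) ⟩
      x * (E a + x * E a + x * G (suc a)) - x * (one + x + x * G 1) * E a
        ≈⟨ -‿cong₂ (*-congˡ (G-split a)) (*-congʳ (*-congˡ G-split-zero)) ⟨
      x * G a - x * G 0 * E a ∎)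

    quadratic : defect 1 ≈ 0# → A ≈ x + x * x + x * A + x * y * (A * A)
    quadratic defect≈0 = begin
      x * G 0                            ≈⟨ *-congˡ G-split-zero ⟩
      -- The vanishing defect trades `x * G 1` for `A * E 1`, and `E 1` involves only `G 0`.
      x * (one + x + x * G 1)            ≈⟨ *-congˡ (+-congˡ (-≈0⇒≈ defect≈0)) ⟩
      x * (one + x + A * E 1)            ≈⟨ *-congˡ (+-congˡ (*-congˡ E-one)) ⟩
      x * (one + x + A * (one + x * (y * G 0)))
        ≈⟨ solve 3 (λ x y g →
             x :* (con (+ 1) :+ x :+ x :* g :* (con (+ 1) :+ x :* (y :* g)))
             := x :+ x :* x :+ x :* (x :* g) :+ x :* y :* ((x :* g) :* (x :* g)))
             refl x y (G 0) ⟩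
      x + x * x + x * A + x * y * (A * A) ∎

  -- Completing the square: T equals 1 - x - 2 x y A, and T * T minus the discriminant is 4 x y
  -- times the difference of the two sides of the quadratic. The powers of x are spelled out as
  -- `_^_` unfolds.
  root-square : ∀ {x y A C} → C ≈ one + A → A ≈ x + x * x + x * A + x * y * (A * A) →
    let T = one - x + two * x * y - two * x * y * C in
    T * T ≈ one - two * x + x * (x * one) - four * (x * (x * one)) * y - four * (x * (x * (x * one))) * y
  root-square {x} {y} {A} {C} C≈ A≈ = -≈0⇒≈ (begin
    (one - x + two * x * y - two * x * y * C) * (one - x + two * x * y - two * x * y * C) - D
      ≈⟨ +-congʳ (*-cong T≈ T≈) ⟩
    (one - x + two * x * y - two * x * y * (one + A)) * (one - x + two * x * y - two * x * y * (one + A)) - D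
      ≈⟨ solve 3 (λ x y a →
           let 1′ = con (+ 1); 2′ = con (+ 2); 4′ = con (+ 4)
               t = 1′ :- x :+ 2′ :* x :* y :- 2′ :* x :* y :* (1′ :+ a)
           in t :* t :- (1′ :- 2′ :* x :+ x :* (x :* 1′) :- 4′ :* (x :* (x :* 1′)) :* y
                 :- 4′ :* (x :* (x :* (x :* 1′))) :* y)
             := 4′ :* x :* y :* ((x :+ x :* x :+ x :* a :+ x :* y :* (a :* a)) :- a)) refl x y A ⟩
    four * x * y * (x + x * x + x * A + x * y * (A * A) - A)
      ≈⟨ *-congˡ (≈⇒-≈0 (sym A≈)) ⟩
    four * x * y * 0#
      ≈⟨ zeroʳ _ ⟩
    0# ∎)
    where
    D = one - two * x + x * (x * one) - four * (x * (x * one)) * y - four * (x * (x * (x * one))) * y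
    T≈ = -‿cong₂ refl (*-congˡ C≈)

  -- Since S + T is 2 plus a multiple of x, the equation (S - T) * (S + T) = 0 expresses 2 (S - T)
  -- as x times a multiple of S - T. Nothing has to be cancelled except the factor 2.
  root-difference : ∀ {x S T u v} → S * S ≈ T * T → S ≈ one + x * u → T ≈ one + x * v →
    two * (S - T) ≈ x * ((S - T) * - (u + v))
  root-difference {x} {S} {T} {u} {v} S²≈T² S≈ T≈ = begin
    two * (S - T)
      ≈⟨ solve 2 (λ s t → con (+ 2) :* (s :- t) :=
           (s :* s :- t :* t) :+ (s :- t) :* :- ((s :- con (+ 1)) :+ (t :- con (+ 1)))) refl S T ⟩
    (S * S - T * T) + (S - T) * - ((S - one) + (T - one))
      ≈⟨ +-cong (≈⇒-≈0 S²≈T²) (*-congˡ (-‿cong (+-cong (+-congʳ S≈) (+-congʳ T≈)))) ⟩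
    0# + (S - T) * - ((one + x * u - one) + (one + x * v - one))
      ≈⟨ +-identityˡ _ ⟩
    (S - T) * - ((one + x * u - one) + (one + x * v - one))
      ≈⟨ solve 4 (λ x d u v →
           d :* :- ((con (+ 1) :+ x :* u :- con (+ 1)) :+ (con (+ 1) :+ x :* v :- con (+ 1)))
           := x :* (d :* :- (u :+ v))) refl x (S - T) u v ⟩
    x * ((S - T) * - (u + v)) ∎

  subtrahend : ∀ {a b S} → S ≈ a - b → b ≈ a - S
  subtrahend {a} {b} {S} S≈ = sym (trans (-‿cong₂ refl S≈)
    (solve 2 (λ a b → a :- (a :- b) := b) refl a b))

open ≡ using (refl)
open import Defs

-- The rings ℤ[y] and ℤ[y][[x]]

module ℤ⟦y⟧ = PowerSeries ℤ.+-*-commutativeRing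

coeff-+ : ∀ p q k → coeff (p +ᴾ q) k ≡ coeff p k ℤ.+ coeff q k
coeff-+ []      q       k       = ≡.sym (ℤ.+-identityˡ _)
coeff-+ (a ∷ p) []      k       = ≡.sym (ℤ.+-identityʳ _)
coeff-+ (a ∷ p) (b ∷ q) zero    = refl
coeff-+ (a ∷ p) (b ∷ q) (suc k) = coeff-+ p q k

coeff-neg : ∀ p k → coeff (-ᴾ p) k ≡ ℤ.- coeff p k
coeff-neg []      k       = refl
coeff-neg (a ∷ p) zero    = refl
coeff-neg (a ∷ p) (suc k) = coeff-neg p k

coeff-scale : ∀ a p k → coeff (map (a ℤ.*_) p) k ≡ a ℤ.* coeff p k
coeff-scale a []      k       = ≡.sym (ℤ.*-zeroʳ a)
coeff-scale a (b ∷ p) zero    = refl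
coeff-scale a (b ∷ p) (suc k) = coeff-scale a p k

coeff-* : ∀ p q k → coeff (p *ᴾ q) k ≡ ℤ⟦y⟧.conv (coeff p) (coeff q) k
coeff-* []      q k       = ≡.sym (ℤ⟦y⟧.conv-zeroˡ (λ _ → refl) (coeff q) k)
coeff-* (a ∷ p) q zero    = ≡.trans (coeff-+ (map (a ℤ.*_) q) _ 0)
  (≡.trans (ℤ.+-identityʳ _) (coeff-scale a q 0))
coeff-* (a ∷ p) q (suc k) = ≡.trans (coeff-+ (map (a ℤ.*_) q) _ (suc k))
  (cong₂ ℤ._+_ (coeff-scale a q (suc k)) (coeff-* p q k))

coeff-1 : ∀ k → coeff 1ᴾ k ≡ ℤ⟦y⟧.one k
coeff-1 zero    = refl
coeff-1 (suc k) = refl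

-- Polynomial equality is equality of coefficient sequences, so `coeff` is an injective homomorphism
-- into power series over ℤ and the ring laws are pulled back along it.
ℤ[y] : CommutativeRing 0ℓ 0ℓ
ℤ[y] = record { isCommutativeRing =
    RingMonomorphism.isCommutativeRing coeff-isMono (CommutativeRing.isCommutativeRing ℤ⟦y⟧.powerSeriesRing) }
  where
  raw : RawRing 0ℓ 0ℓ
  raw = record
    { _≈_ = _≈ᴾ_ ; _+_ = _+ᴾ_ ; _*_ = _*ᴾ_ ; -_ = -ᴾ_ ; 0# = 0ᴾ ; 1# = 1ᴾ }

  open RingMorphisms raw (CommutativeRing.rawRing ℤ⟦y⟧.powerSeriesRing)

  coeff-isMono : IsRingMonomorphism coeff
  coeff-isMono = record
    { isRingHomomorphism = record
      { isSemiringHomomorphism = record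
        { isNearSemiringHomomorphism = record
          { +-isMonoidHomomorphism = record
            { isMagmaHomomorphism = record
              { isRelHomomorphism = record { cong = id }
              ; homo = coeff-+
              }
            ; ε-homo = λ _ → refl
            }
          ; *-homo = coeff-*
          }
        ; 1#-homo = coeff-1
        }
      ; -‿homo = coeff-neg
      }
    ; injective = id
    }

module ℤ[y] = CommutativeRing ℤ[y]
module ℤ[y]⟦x⟧ = PowerSeries ℤ[y]

-- Rewritten with `applyUpTo`, the finite sum exposes its first summand, which is what the recursion
-- of `conv` peels off.
*≈conv : ∀ f g n → (f * g) n ≈ᴾ ℤ[y]⟦x⟧.conv f g n
*≈conv f g n k = ≡.trans
  (cong (λ ps → coeff (sumᴾ ps) k) (map-upTo (λ i → f i *ᴾ g (n ∸ i)) (suc n))) (go f n k)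
  where
  go : ∀ f n → sumᴾ (applyUpTo (λ i → f i *ᴾ g (n ∸ i)) (suc n)) ≈ᴾ ℤ[y]⟦x⟧.conv f g n
  go f zero    = ℤ[y].+-identityʳ (f 0 *ᴾ g 0)
  go f (suc n) = ℤ[y].+-congˡ {f 0 *ᴾ g (suc n)} {z} {z′} (go (f ∘ suc) n)
    where
    z  = sumᴾ (applyUpTo (λ i → f (suc i) *ᴾ g (n ∸ i)) (suc n))
    z′ = ℤ[y]⟦x⟧.conv (f ∘ suc) g n

#1≈one : ∀ n → (# 1) n ≈ᴾ ℤ[y]⟦x⟧.one n
#1≈one zero    = ℤ[y].refl {1ᴾ}
#1≈one (suc n) = ℤ[y].refl {0ᴾ}

seriesRing : CommutativeRing 0ℓ 0ℓ
seriesRing = record { isCommutativeRing =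
    RingMonomorphism.isCommutativeRing id-isMono (CommutativeRing.isCommutativeRing ℤ[y]⟦x⟧.powerSeriesRing) }
  where
  raw : RawRing 0ℓ 0ℓ
  raw = record
    { _≈_ = _≈_ ; _+_ = _+_ ; _*_ = _*_ ; -_ = λ f n → -ᴾ f n ; 0# = λ _ → 0ᴾ ; 1# = # 1 }

  open RingMorphisms raw (CommutativeRing.rawRing ℤ[y]⟦x⟧.powerSeriesRing)

  id-isMono : IsRingMonomorphism id
  id-isMono = record
    { isRingHomomorphism = record
      { isSemiringHomomorphism = record
        { isNearSemiringHomomorphism = record
          { +-isMonoidHomomorphism = record
            { isMagmaHomomorphism = record
              { isRelHomomorphism = record { cong = id }
              ; homo = λ f g n → ℤ[y].refl {f n +ᴾ g n}
              }
            ; ε-homo = λ _ → ℤ[y].refl {0ᴾ}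
            }
          ; *-homo = *≈conv
          }
        ; 1#-homo = #1≈one
        }
      ; -‿homo = λ f n → ℤ[y].refl { -ᴾ f n}
      }
    ; injective = id
    }

-- Enumeration by first letter

avoids : List ℕ → Bool
avoids w = does (avoids? _≟_ _≤?_ w)

-- Words containing the pattern weigh zero instead of being filtered out, so sums over all words can
-- be split by their leading letters.
weight : List ℕ → Poly
weight w = if avoids w then y^ des w else 0ᴾ

total : List (List ℕ) → Poly
total ws = sumᴾ (map weight ws)

C≡total : ∀ n → C _≟_ _≤?_ n ≡ total (catalanWords n)
C≡total n = go (catalanWords n)
  where
  go : ∀ ws → sumᴾ (map (λ w → y^ des w) (filter (avoids? _≟_ _≤?_) ws)) ≡ total ws
  go []       = refl
  go (w ∷ ws) with avoids w
  ... | true  = cong (y^ des w +ᴾ_) (go ws)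
  ... | false = go ws

-- Multiplication by y, that is, one more descent.
shift : Poly → Poly
shift p = ℤ.0ℤ ∷ p

shift-zero : 0ᴾ ≈ᴾ shift 0ᴾ
shift-zero zero    = refl
shift-zero (suc k) = refl

-- Effect of a prepended letter on the weight.

des-> : ∀ {a b} → b < a → ∀ v → des (a ∷ b ∷ v) ≡ suc (des (b ∷ v))
des-> {a} {b} b<a v rewrite dec-true (b <? a) b<a = refl

des-≤ : ∀ {a b} → a ≤ b → ∀ v → des (a ∷ b ∷ v) ≡ des (b ∷ v)
des-≤ {a} {b} a≤b v rewrite dec-false (b <? a) (≤⇒≯ a≤b) = refl

avoids-≢ : ∀ {a b} → a ≢ b → ∀ v → avoids (a ∷ b ∷ v) ≡ avoids (b ∷ v)
avoids-≢ a≢b []      = refl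
avoids-≢ {a} {b} a≢b (c ∷ v) rewrite dec-false (a ≟ b) a≢b = refl

-- The only new occurrence could be at the front, and it fails at its second relation whether or not
-- a equals b.
avoids-≰ : ∀ {a b c} → c < b → ∀ v → avoids (a ∷ b ∷ c ∷ v) ≡ avoids (b ∷ c ∷ v)
avoids-≰ {a} {b} {c} c<b v with does (a ≟ b)
... | false = refl
... | true rewrite dec-false (b ≤? c) (<⇒≱ c<b) = refl

weight-> : ∀ {a b} → b < a → ∀ v → weight (a ∷ b ∷ v) ≈ᴾ shift (weight (b ∷ v))
weight-> {a} {b} b<a v rewrite avoids-≢ (≢-sym (<⇒≢ b<a)) v | des-> b<a v with avoids (b ∷ v)
... | true  = λ _ → refl
... | false = shift-zero

weight-suc : ∀ a v → weight (a ∷ suc a ∷ v) ≡ weight (suc a ∷ v)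
weight-suc a v rewrite avoids-≢ (<⇒≢ (n<1+n a)) v | des-≤ (n≤1+n a) v = refl

weight-≡> : ∀ {a b} → b < a → ∀ v → weight (a ∷ a ∷ b ∷ v) ≈ᴾ shift (weight (b ∷ v))
weight-≡> {a} {b} b<a v rewrite avoids-≰ {a} b<a v | des-≤ (≤-refl {a}) (b ∷ v) = weight-> b<a v

weight-≡≤ : ∀ a b → a ≤ b → ∀ v → weight (a ∷ a ∷ b ∷ v) ≡ 0ᴾ
weight-≡≤ a b a≤b v rewrite dec-true (a ≟ a) refl | dec-true (a ≤? b) a≤b = refl

weight-pair : ∀ a → weight (a ∷ a ∷ []) ≡ 1ᴾ
weight-pair a rewrite des-≤ (≤-refl {a}) [] = refl

total-++ : ∀ us vs → total (us ++ vs) ≈ᴾ total us +ᴾ total vs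
total-++ []       vs = λ _ → refl
total-++ (u ∷ us) vs = ℤ[y].trans {total (u ∷ us ++ vs)} {weight u +ᴾ (total us +ᴾ total vs)}
  {total (u ∷ us) +ᴾ total vs}
  (ℤ[y].+-congˡ {weight u} {total (us ++ vs)} {total us +ᴾ total vs} (total-++ us vs))
  (ℤ[y].sym {total (u ∷ us) +ᴾ total vs} {weight u +ᴾ (total us +ᴾ total vs)}
    (ℤ[y].+-assoc (weight u) (total us) (total vs)))

module _ (f g : List ℕ → List ℕ) where

  total-map-≡ : (∀ v → weight (f v) ≡ weight (g v)) → ∀ us → total (map f us) ≡ total (map g us)
  total-map-≡ f≡g []       = refl
  total-map-≡ f≡g (u ∷ us) = cong₂ _+ᴾ_ (f≡g u) (total-map-≡ f≡g us)

  total-map-shift : (∀ v → weight (f v) ≈ᴾ shift (weight (g v))) →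
                    ∀ us → total (map f us) ≈ᴾ shift (total (map g us))
  total-map-shift f≈g []       = shift-zero
  total-map-shift f≈g (u ∷ us) = ℤ[y].+-cong
    {weight (f u)} {shift (weight (g u))} {total (map f us)} {shift (total (map g us))}
    (f≈g u) (total-map-shift f≈g us)

total-map-0 : ∀ (f : List ℕ → List ℕ) → (∀ v → weight (f v) ≡ 0ᴾ) → ∀ us → total (map f us) ≡ 0ᴾ
total-map-0 f f≡0 []       = refl
total-map-0 f f≡0 (u ∷ us) = cong₂ _+ᴾ_ (f≡0 u) (total-map-0 f f≡0 us)

-- `wordsFrom a n` with the first letter stripped, so that leading letters become visible to the
-- weight lemmas.
tails : ℕ → ℕ → List (List ℕ)
tails a zero    = [] ∷ []
tails a (suc n) = concatMap (λ b → wordsFrom b n) (upTo (suc (suc a)))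

wordsFrom≡map-tails : ∀ a n → wordsFrom a n ≡ map (a ∷_) (tails a n)
wordsFrom≡map-tails a zero    = refl
wordsFrom≡map-tails a (suc n) = refl

-- The coefficient of xⁿ sums y^des over the avoiding words of length n + 1 with first
-- letter a (G) or with first letter below a (H), and those of length n + 2
-- beginning with a a (E).
G E H : ℕ → Series
G a n = total (wordsFrom a n)
E a n = total (map (a ∷_) (wordsFrom a n))
H zero    n = 0ᴾ
H (suc a) n = H a n +ᴾ G a n

-- The case `below (suc (suc a)) n` is `tails a (suc n)`: the letter after a is at most a + 1.
below : ℕ → ℕ → List (List ℕ)
below m n = concatMap (λ b → wordsFrom b n) (upTo m)

below-suc : ∀ m n → below (suc m) n ≡ below m n ++ wordsFrom m n
below-suc m n = begin
  concatMap ws (upTo (suc m))           ≡⟨ cong (concatMap ws) (upTo-∷ʳ m) ⟨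
  concatMap ws (upTo m ++ m ∷ [])       ≡⟨ concatMap-++ ws (upTo m) (m ∷ []) ⟩
  below m n ++ (wordsFrom m n ++ [])    ≡⟨ cong (below m n ++_) (++-identityʳ _) ⟩
  below m n ++ wordsFrom m n            ∎
  where
  open ≡.≡-Reasoning
  ws = λ b → wordsFrom b n

total-below-suc : ∀ f m n → total (map f (below (suc m) n)) ≈ᴾ
                  total (map f (below m n)) +ᴾ total (map (f ∘ (m ∷_)) (tails m n))
total-below-suc f m n k = ≡.trans
  (cong (λ ws → coeff (total ws) k) (begin
    map f (below (suc m) n)
      ≡⟨ cong (map f) (below-suc m n) ⟩
    map f (below m n ++ wordsFrom m n)
      ≡⟨ map-++ f (below m n) (wordsFrom m n) ⟩
    map f (below m n) ++ map f (wordsFrom m n)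
      ≡⟨ cong (λ ws → map f (below m n) ++ map f ws) (wordsFrom≡map-tails m n) ⟩
    map f (below m n) ++ map f (map (m ∷_) (tails m n))
      ≡⟨ cong (map f (below m n) ++_) (map-∘ (tails m n)) ⟨
    map f (below m n) ++ map (f ∘ (m ∷_)) (tails m n) ∎))
  (total-++ (map f (below m n)) (map (f ∘ (m ∷_)) (tails m n)) k)
  where open ≡.≡-Reasoning

total-below : ∀ f m n → (∀ {b} → b < m → ∀ v → weight (f (b ∷ v)) ≈ᴾ shift (weight (b ∷ v))) →
              total (map f (below m n)) ≈ᴾ shift (H m n)
total-below f zero    n f≈ = shift-zero
total-below f (suc m) n f≈ k = ≡.trans
  (total-below-suc f m n k)
  (ℤ[y].+-cong {total (map f (below m n))} {shift (H m n)}
    {total (map (f ∘ (m ∷_)) (tails m n))} {shift (G m n)}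
    (total-below f m n (λ b<m → f≈ (m<n⇒m<1+n b<m))) last k)
  where
  last : total (map (f ∘ (m ∷_)) (tails m n)) ≈ᴾ shift (G m n)
  last k = ≡.trans (total-map-shift (f ∘ (m ∷_)) (m ∷_) (f≈ (n<1+n m)) (tails m n) k)
    (cong (λ ws → coeff (shift (total ws)) k) (≡.sym (wordsFrom≡map-tails m n)))

-- The three cases for the letter after a: smaller than a, equal to a, or a + 1. The map `f` puts
-- the preceding letters back.
total-below-2+ : ∀ f a n → (∀ {b} → b < a → ∀ v → weight (f (b ∷ v)) ≈ᴾ shift (weight (b ∷ v))) →
  total (map f (below (suc (suc a)) n)) ≈ᴾ
  shift (H a n) +ᴾ total (map (f ∘ (a ∷_)) (tails a n)) +ᴾ
    total (map (f ∘ (suc a ∷_)) (tails (suc a) n))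
total-below-2+ f a n f≈ k = ≡.trans
  (total-below-suc f (suc a) n k)
  (ℤ[y].+-congʳ {r} {total (map f (below (suc a) n))} {shift (H a n) +ᴾ q}
    (λ k → ≡.trans (total-below-suc f a n k)
      (ℤ[y].+-congʳ {q} {total (map f (below a n))} {shift (H a n)} (total-below f a n f≈) k)) k)
  where
  q = total (map (f ∘ (a ∷_)) (tails a n))
  r = total (map (f ∘ (suc a ∷_)) (tails (suc a) n))

G-coeff-suc : ∀ a n → G a (suc n) ≈ᴾ shift (H a n) +ᴾ E a n +ᴾ G (suc a) n
G-coeff-suc a n k = ≡.trans
  (total-below-2+ (a ∷_) a n (λ b<a → weight-> b<a) k)
  (cong₂ (λ p q → coeff (shift (H a n) +ᴾ p +ᴾ q) k) equal ascent)
  where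
  equal : total (map (λ v → a ∷ a ∷ v) (tails a n)) ≡ E a n
  equal = cong total (≡.trans (map-∘ (tails a n)) (cong (map (a ∷_)) (≡.sym (wordsFrom≡map-tails a n))))

  ascent : total (map (λ v → a ∷ suc a ∷ v) (tails (suc a) n)) ≡ G (suc a) n
  ascent = ≡.trans (total-map-≡ (λ v → a ∷ suc a ∷ v) (suc a ∷_) (weight-suc a) (tails (suc a) n))
    (cong total (≡.sym (wordsFrom≡map-tails (suc a) n)))

-- After a repeated a, a next letter a or a + 1 completes the pattern. Only a descent survives, and
-- behind it the repetition no longer matters.
E-coeff-suc : ∀ a n → E a (suc n) ≈ᴾ shift (H a n)
E-coeff-suc a n k = ≡.trans
  (cong (λ ws → coeff (total ws) k) (≡.sym (map-∘ (below (suc (suc a)) n)))) (≡.trans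
  (total-below-2+ (λ v → a ∷ a ∷ v) a n (λ b<a → weight-≡> b<a) k)
  (cong₂ (λ p q → coeff (shift (H a n) +ᴾ p +ᴾ q) k)
    (total-map-0 (λ v → a ∷ a ∷ a ∷ v) (weight-≡≤ a a ≤-refl) (tails a n))
    (total-map-0 (λ v → a ∷ a ∷ suc a ∷ v) (weight-≡≤ a (suc a) (n≤1+n a)) (tails (suc a) n))))

E-coeff-zero : ∀ a → E a 0 ≈ᴾ 1ᴾ
E-coeff-zero a rewrite weight-pair a = λ _ → refl

-- Divisibility by powers of x

module S = CommutativeRing seriesRing

const-* : ∀ p f n → (const p * f) n ≈ᴾ p *ᴾ f n
const-* p f n = ℤ[y].trans {(const p * f) n} {ℤ[y]⟦x⟧.conv (const p) f n} {p *ᴾ f n}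
  (*≈conv (const p) f n) (ℤ[y]⟦x⟧.conv-const {const p} (λ _ _ → refl) f n)

singleton-* : ∀ a p k → coeff ((a ∷ []) *ᴾ p) k ≡ a ℤ.* coeff p k
singleton-* a p k = ≡.trans (coeff-* (a ∷ []) p k) (ℤ⟦y⟧.conv-const (λ _ → refl) (coeff p) k)

x*-zero : ∀ f → (x * f) 0 ≈ᴾ 0ᴾ
x*-zero f = *≈conv x f 0

x*-suc : ∀ f n → (x * f) (suc n) ≈ᴾ f n
x*-suc f n k = ≡.trans (*≈conv x f (suc n) k)
  (≡.trans (ℤ[y]⟦x⟧.conv-const {x ∘ suc} (λ _ _ → refl) f n k) (ℤ[y].*-identityˡ (f n) k))

y*-shift : ∀ f n → (y * f) n ≈ᴾ shift (f n)
y*-shift f n k = ≡.trans (const-* (y^ 1) f n k) (≡.trans (coeff-* (y^ 1) (f n) k) (go k))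
  where
  go : ∀ k → ℤ⟦y⟧.conv (coeff (y^ 1)) (coeff (f n)) k ≡ coeff (shift (f n)) k
  go zero    = refl
  go (suc k) = ≡.trans (ℤ.+-identityˡ _)
    (≡.trans (ℤ⟦y⟧.conv-const {coeff 1ᴾ} (λ _ → refl) (coeff (f n)) k) (ℤ.*-identityˡ _))

-- Turns recurrences between coefficients into equations between series.
head-tail : ∀ f g → f 0 ≈ᴾ 1ᴾ → (∀ n → f (suc n) ≈ᴾ g n) → f ≈ # 1 + x * g
head-tail f g f₀ f₁ zero    k = ≡.trans (f₀ k) (≡.sym
  (≡.trans (coeff-+ 1ᴾ ((x * g) 0) k)
    (≡.trans (cong (ℤ._+_ (coeff 1ᴾ k)) (x*-zero g k)) (ℤ.+-identityʳ _))))
head-tail f g f₀ f₁ (suc n) k = ≡.trans (f₁ n k) (≡.sym (x*-suc g n k))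

constants : CommutativeRing.rawRing ℤ.+-*-commutativeRing
            -Raw-AlmostCommutative⟶ fromCommutativeRing seriesRing
constants = record
  { ⟦_⟧    = ι
  ; +-homo = λ { a b zero k → refl ; a b (suc n) k → refl }
  ; *-homo = *-homo
  ; -‿homo = λ { a zero k → refl ; a (suc n) k → refl }
  ; 0-homo = λ { zero zero → refl ; zero (suc k) → refl ; (suc n) k → refl }
  ; 1-homo = λ _ _ → refl
  }
  where
  ι : ℤ → Series
  ι a = const (a ∷ [])

  *-homo : ∀ a b → ι (a ℤ.* b) ≈ ι a * ι b
  *-homo a b n k = ≡.sym (≡.trans (const-* (a ∷ []) (ι b) n k)
    (≡.trans (singleton-* a (ι b n) k) (go n k)))
    where
    go : ∀ n k → a ℤ.* coeff (ι b n) k ≡ coeff (ι (a ℤ.* b) n) k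
    go zero    zero    = refl
    go zero    (suc k) = ℤ.*-zeroʳ a
    go (suc n) k       = ℤ.*-zeroʳ a

open CatalanAlgebra seriesRing constants

open ℤ[y]⟦x⟧ using (Vanishes)

vanishes-+ : ∀ {n} f g → Vanishes n f → Vanishes n g → Vanishes n (f + g)
vanishes-+ f g f≈0 g≈0 {m} m<n = ℤ[y].+-cong {f m} {0ᴾ} {g m} {0ᴾ} (f≈0 m<n) (g≈0 m<n)

vanishes-* : ∀ {n} f g → Vanishes n f → Vanishes n (f * g)
vanishes-* {n} f g f≈0 {m} m<n k =
  ≡.trans (*≈conv f g m k) (ℤ[y]⟦x⟧.conv-vanishes f g n f≈0 m<n k)

vanishes-x* : ∀ {n} f → Vanishes n f → Vanishes (suc n) (x * f)
vanishes-x* f f≈0 {zero}  _         = x*-zero f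
vanishes-x* f f≈0 {suc m} (s≤s m<n) k = ≡.trans (x*-suc f m k) (f≈0 m<n k)

vanishes-resp : ∀ {n} f g → f ≈ g → Vanishes n g → Vanishes n f
vanishes-resp f g f≈g g≈0 {m} m<n k = ≡.trans (f≈g m k) (g≈0 m<n k)

-- Each coefficient is an integer, and 2 cancels in ℤ.
vanishes-#2* : ∀ {n} f → Vanishes n (# 2 * f) → Vanishes n f
vanishes-#2* f 2f≈0 {m} m<n k = ℤ.*-cancelˡ-≡ (+ 2) (coeff (f m) k) ℤ.0ℤ
  (≡.trans (≡.sym (≡.trans (const-* (+ 2 ∷ []) f m k) (singleton-* (+ 2) (f m) k))) (2f≈0 m<n k))

vanishes⇒≈0 : ∀ f → (∀ n → Vanishes n f) → f ≈ S.0#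
vanishes⇒≈0 f f≈0 n = f≈0 (suc n) (n<1+n n)

-- Each use of `recursion` raises by one the power of x known to divide `s - t`.
sqrt-unique : ∀ {D} s t → s IsSqrtOf D → t IsSqrtOf D → s ≈ t
sqrt-unique {D} s t s-root t-root = -≈0⇒≈ {s} {t} (vanishes⇒≈0 (s - t) s-t-vanishes)
  where
  module s = _IsSqrtOf_ s-root
  module t = _IsSqrtOf_ t-root

  expand : ∀ f → f 0 ≈ᴾ 1ᴾ → f ≈ # 1 + x * (f ∘ suc)
  expand f f₀ = head-tail f (f ∘ suc) f₀ (λ _ _ → refl)

  w : Series
  w = S.- ((s ∘ suc) + (t ∘ suc))

  recursion : # 2 * (s - t) ≈ x * ((s - t) * w)
  recursion = root-difference {x} {s} {t} {s ∘ suc} {t ∘ suc}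
    (S.trans {s * s} {D} {t * t} s.square (S.sym {t * t} {D} t.square))
    (expand s s.constantTerm) (expand t t.constantTerm)

  s-t-vanishes : ∀ n → Vanishes n (s - t)
  s-t-vanishes zero    ()
  s-t-vanishes (suc n) = vanishes-#2* (s - t)
    (vanishes-resp (# 2 * (s - t)) (x * ((s - t) * w)) recursion
      (vanishes-x* ((s - t) * w) (vanishes-* (s - t) w (s-t-vanishes n))))

-- Functional equations, vanishing of the defects, and the closed form.

G-rec : ∀ a → G a ≈ # 1 + x * (y * H a + E a + G (suc a))
G-rec a = head-tail (G a) (y * H a + E a + G (suc a)) (λ _ → refl) λ n k → ≡.trans (G-coeff-suc a n k)
  (ℤ[y].+-congʳ {G (suc a) n} {shift (H a n) +ᴾ E a n} {(y * H a + E a) n}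
    (ℤ[y].+-congʳ {E a n} {shift (H a n)} {(y * H a) n} (λ k → ≡.sym (y*-shift (H a) n k))) k)

E-rec : ∀ a → E a ≈ # 1 + x * (y * H a)
E-rec a = head-tail (E a) (y * H a) (E-coeff-zero a) λ n k →
  ≡.trans (E-coeff-suc a n k) (≡.sym (y*-shift (H a) n k))

open Decomposition x y G E H G-rec E-rec (λ _ _ → refl) (λ _ _ _ → refl)

-- Induction on the order of vanishing, for all letters at once, because the contraction at `a` also
-- refers to the defects at `suc a` and at 1.
defect≈0 : ∀ a → defect a ≈ S.0#
defect≈0 a = vanishes⇒≈0 (defect a) (λ n → defect-vanishes n a)
  where
  defect-vanishes : ∀ n a → Vanishes n (defect a)
  defect-vanishes zero    a ()
  defect-vanishes (suc n) a = vanishes-resp (defect a) (x * (d₁ + (d₂ + d₃))) (defect-contracts a)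
    (vanishes-x* (d₁ + (d₂ + d₃)) (vanishes-+ d₁ (d₂ + d₃) (defect-vanishes n (suc a))
      (vanishes-+ d₂ d₃ (vanishes-* (defect a) (y * A) (defect-vanishes n a))
        (vanishes-* (defect 1) (S.- E a) (defect-vanishes n 1)))))
    where
    d₁ = defect (suc a)
    d₂ = defect a * (y * A)
    d₃ = defect 1 * (S.- E a)

-- The empty word gives the constant term; every other Catalan word starts with 0 and so is
-- enumerated by `x * G 0`.
C≈1+A : C _≟_ _≤?_ ≈ # 1 + A
C≈1+A = head-tail (C _≟_ _≤?_) (G 0) (λ _ → refl) (λ n k → cong (λ p → coeff p k) (C≡total (suc n)))

theorem3p4 : let D = # 1 - # 2 * x + x ^ 2 - # 4 * x ^ 2 * y - # 4 * x ^ 3 * y in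
    (∃ λ S → S IsSqrtOf D) ×
    (∀ S → S IsSqrtOf D →
    # 2 * x * y * C _≟_ _≤?_ ≈ # 1 - x + # 2 * x * y - S)
-- `T` comes from solving the claimed formula for the root. Uniqueness identifies any root with `T`,
-- and the formula is recovered by rearranging.
theorem3p4 = (T , T-root) , λ S S-root →
  subtrahend {# 1 - x + # 2 * x * y} {# 2 * x * y * C _≟_ _≤?_} {S} (sqrt-unique S T S-root T-root)
  where
  T : Series
  T = # 1 - x + # 2 * x * y - # 2 * x * y * C _≟_ _≤?_

  T-root : T IsSqrtOf (# 1 - # 2 * x + x ^ 2 - # 4 * x ^ 2 * y - # 4 * x ^ 3 * y)
  T-root = record
    { square = root-square {x} {y} {A} {C _≟_ _≤?_} C≈1+A (quadratic (defect≈0 1))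
    -- The constant term evaluates to the list with entries 1 and 0; its trailing zero needs a case
    -- of its own.
    ; constantTerm = λ { zero → refl ; (suc zero) → refl ; (suc (suc k)) → refl }
    }
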